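{- Let $G$ be a connected graph with a pendant vertex $u$, and let $v$ be the unique neighbour of $u$, assumed to be a cut-vertex of $G$. If $G-\{v,u\}$ has at least two connected components, then $u$ is not a basis forced vertex of $G$.
   Context: All graphs are finite and simple. A pendant is a vertex with exactly one neighbour; a cut-vertex is a vertex $v$ such that $G-v$ is disconnected. For vertices $x,y$ of a connected graph $G$, $d(x,y)$ is the length of a shortest $x$–$y$ path. A set $R\subseteq V(G)$ is a resolving set if for all distinct $x,y\in V(G)$ there is $r\in R$ with $d(r,x)\neq d(r,y)$. The metric dimension $\dim(G)$ is the minimum cardinality of a resolving set, and a resolving set of cardinality $\dim(G)$ is a metric basis. A vertex is a basis forced vertex if it belongs to every metric basis of $G$. -}

module Defs where

open import Data.Fin.Base using (Fin)
open import Data.Fin.Subset using (Subset; _∈_; _∉_; ∣_∣; ⁅_⁆)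
open import Data.List.Base using (List; []; _∷_)
open import Data.List.Relation.Unary.Unique.Propositional using (Unique)
open import Data.Nat.Base using (ℕ; zero; suc; _≤_)
open import Data.Product.Base using (Σ-syntax; ∃; ∃₂; _×_)
open import Data.Product using (∃!)
open import Data.Refinement using (Refinement-syntax; value)
open import Level using (0ℓ)
open import Relation.Binary.Core using (Rel)
open import Relation.Binary.Definitions using (Decidable; Irreflexive; Symmetric)
open import Relation.Binary.PropositionalEquality using (_≡_; _≢_; refl)
open import Relation.Nullary using (¬_)
open import Relation.Unary using (Pred; _≐_)

record Graph (V : Set) : Set₁ where
  field
    Adj    : Rel V 0ℓ
    adj?   : Decidable Adj
    sym    : Symmetric Adj
    irrefl : Irreflexive _≡_ Adj

module _ {V : Set} (G : Graph V) where
  open Graph G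

  data Walk : V → V → ℕ → Set where
    [_]    : ∀ x → Walk x x zero
    _∷⟨_⟩_ : ∀ x {y z k} → Adj x y → Walk y z k → Walk x z (suc k)

  vertices : ∀ {x y k} → Walk x y k → List V
  vertices [ x ]          = x ∷ []
  vertices (x ∷⟨ _ ⟩ w) = x ∷ vertices w

  Path : V → V → ℕ → Set
  Path x y k = Σ[ w ∈ Walk x y k ] Unique (vertices w)

  Joined : Rel V 0ℓ
  Joined x y = ∃ λ k → Path x y k

  Connected : Set
  Connected = ∀ x y → Joined x y

  IsComponent : Pred V 0ℓ → Set
  IsComponent C = ∃ λ x → C ≐ Joined x

  AtLeastTwoComponents : Set₁
  AtLeastTwoComponents = ∃₂ λ C D → IsComponent C × IsComponent D × ¬ (C ≐ D)

  Pendant : V → Set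
  Pendant x = ∃! _≡_ (Adj x)

  -- d(x,y) = k, as a relation: d is a total function only on connected graphs.
  Distance : V → V → ℕ → Set
  Distance x y k = Path x y k × (∀ {l} → Path x y l → k ≤ l)

  Resolves : V → V → V → Set
  Resolves r x y = ∃₂ λ k l → Distance r x k × Distance r y l × k ≢ l

infixl 6 _−_

-- The membership proof in a refinement type is irrelevant, so vertices of
-- G − S are equal exactly when the underlying vertices of G are.
_−_ : ∀ {n} → Graph (Fin n) → (S : Subset n) → Graph [ x ∈ Fin n ∣ x ∉ S ]
G − S = record
  { Adj    = λ x y → Adj (value x) (value y)
  ; adj?   = λ x y → adj? (value x) (value y)
  ; sym    = sym
  ; irrefl = λ { refl → irrefl refl }
  }
  where open Graph G

module _ {n : ℕ} (G : Graph (Fin n)) where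

  CutVertex : Fin n → Set
  CutVertex x = ¬ Connected (G − ⁅ x ⁆)

  ResolvingSet : Subset n → Set
  ResolvingSet R = ∀ x y → x ≢ y → ∃ λ r → r ∈ R × Resolves G r x y

  MetricDimension : ℕ → Set
  MetricDimension k =
    (∃ λ R → ResolvingSet R × ∣ R ∣ ≡ k) × (∀ R → ResolvingSet R → k ≤ ∣ R ∣)

  MetricBasis : Subset n → Set
  MetricBasis R = ResolvingSet R × MetricDimension ∣ R ∣

  BasisForced : Fin n → Set
  BasisForced x = ∀ R → MetricBasis R → x ∈ R

{-# OPTIONS --safe #-}

-- Let R be a metric basis containing u, and call y a twin of u if y ≠ u is a
-- neighbour of v and no vertex of R − u separates y from u.  Two distinct twins
-- would be separated neither by R − u nor by u, so there is at most one.  Let R'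
-- be R − u together with the twin, if there is one.
-- Every component of G − {u,v} meets R': it contains a neighbour of v, which is
-- either the twin or separated from u by some r in R − u; such an r must lie in
-- the same component.  As there are two components, for every y some r in R'
-- satisfies d(r,y) = d(r,v) + d(v,y), and this r separates y from every x with
-- d(v,x) < d(v,y).  Vertices other than u at equal distance from v are not
-- separated by u, so they are separated by R − u; and a neighbour of v is
-- separated from u by R − u or, if it is the twin, by itself.
-- So R' resolves G, avoids u and is no larger than R.
module Submission where

open import Defs
open import Data.Bool.Base using (false; true)
open import Data.Empty using (⊥-elim-irr)
open import Data.Fin.Base using (Fin; zero; suc)
open import Data.Fin.Properties using (_≟_; any?; all?; ¬∀⟶∃¬)
open import Data.Fin.Subset using (Subset; _∈_; _∉_; _⊆_; ∣_∣; ⁅_⁆; _∪_; _-_; ⊤)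
open import Data.Fin.Subset.Properties using (_∈?_; ∈⊤; ∪-identityʳ; x∈⁅x⁆; x∈⁅y⁆⇒x≡y; x∈p∪q⁺; x∈p∪q⁻; x∈p∧x≢y⇒x∈p-y; x∈p⇒∣p-x∣<∣p∣)
open import Data.Irrelevant using ([_])
open import Data.List.Membership.Propositional using () renaming (_∈_ to _∈ₗ_)
open import Data.List.Relation.Unary.All using ([]; _∷_)
open import Data.List.Relation.Unary.All.Properties using (¬Any⇒All¬)
open import Data.List.Relation.Unary.AllPairs using ([]; _∷_)
open import Data.List.Relation.Unary.Unique.Propositional using (Unique)
open import Data.List.Relation.Unary.Any using (here; there)
import Data.List.Relation.Unary.Any as Any
open import Data.Nat.Base using (ℕ; zero; suc; _+_; _≤_; _<_; z≤n; s≤s)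
open import Data.Nat.Induction using (<-wellFounded)
open import Data.Nat.Properties using (≤-refl; ≤-reflexive; ≤-trans; ≤-antisym; n≢0⇒n>0; m≤n⇒m≤1+n; n≮n; n≤0⇒n≡0; <⇒≢; ≮⇒≥; <-cmp; +-comm; +-suc; +-identityʳ; +-monoˡ-≤; +-monoʳ-<; +-monoʳ-≤; module ≤-Reasoning) renaming (_≟_ to _≟ⁿ_)
open import Data.Product.Base using (∃; _×_; _,_; proj₁; proj₂)
open import Data.Refinement using (value; _,_; value-injective; Refinement-syntax)
import Data.Refinement.Properties as Refinement
open import Data.Sum.Base using (_⊎_; inj₁; inj₂)
open import Data.Vec.Base using (_∷_; there)
open import Function.Base using (_∘_)
open import Induction.WellFounded using (Acc; acc)
open import Relation.Binary.Definitions using (DecidableEquality; tri<; tri≈; tri>)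
open import Relation.Binary.PropositionalEquality using (_≡_; _≢_; refl; sym; trans; cong; subst; ≢-sym)
open import Relation.Nullary using (¬_; Dec; yes; no; contradiction)
open import Relation.Nullary.Decidable using (map′; _×-dec_; _→-dec_; ¬?)
import Relation.Unary as U

-- Subset cardinalities and least witnesses.

x∉p-x : ∀ {n} (p : Subset n) (x : Fin n) → x ∉ p - x
x∉p-x (_ ∷ p) (suc x) (there x∈) = x∉p-x p x x∈

∣p∪⁅x⁆∣≤1+∣p∣ : ∀ {n} (p : Subset n) (x : Fin n) → ∣ p ∪ ⁅ x ⁆ ∣ ≤ suc ∣ p ∣
∣p∪⁅x⁆∣≤1+∣p∣ (true  ∷ p) zero    rewrite ∪-identityʳ p = s≤s (m≤n⇒m≤1+n ≤-refl)
∣p∪⁅x⁆∣≤1+∣p∣ (false ∷ p) zero    rewrite ∪-identityʳ p = ≤-refl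
∣p∪⁅x⁆∣≤1+∣p∣ (true  ∷ p) (suc x) = s≤s (∣p∪⁅x⁆∣≤1+∣p∣ p x)
∣p∪⁅x⁆∣≤1+∣p∣ (false ∷ p) (suc x) = ∣p∪⁅x⁆∣≤1+∣p∣ p x

least : {P : ℕ → Set} → U.Decidable P → ∀ k → P k →
        ∃ λ m → P m × (∀ {l} → P l → m ≤ l)
least P? zero    p = 0 , p , λ _ → z≤n
least P? (suc k) p with P? 0
... | yes p₀ = 0 , p₀ , λ _ → z≤n
... | no ¬p₀ with least (P? ∘ suc) k p
...   | m , pₘ , m≤ = suc m , pₘ , λ
  { {zero}  p₀ → contradiction p₀ ¬p₀
  ; {suc _} pₗ → s≤s (m≤ pₗ) }

-- Walks, paths and components.

module _ {V : Set} {G : Graph V} where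
  open Graph G using (Adj) renaming (sym to adj-sym)

  _++ʷ_ : ∀ {x y z k l} → Walk G x y k → Walk G y z l → Walk G x z (k + l)
  [ _ ]        ++ʷ w′ = w′
  (x ∷⟨ e ⟩ w) ++ʷ w′ = x ∷⟨ e ⟩ (w ++ʷ w′)

  reverse : ∀ {x y k} → Walk G x y k → Walk G y x k
  reverse [ x ] = [ x ]
  reverse {k = suc k} (_∷⟨_⟩_ x {y} e w) =
    subst (Walk G _ x) (trans (+-suc k 0) (cong suc (+-identityʳ k)))
      (reverse w ++ʷ (y ∷⟨ adj-sym e ⟩ [ x ]))

  -- Walks concatenate and reverse with no uniqueness to restore, so this relation replaces `Joined`
  -- in the proof.
  Linked : V → V → Set
  Linked x y = ∃ λ k → Walk G x y k

  linked-sym : ∀ {x y} → Linked x y → Linked y x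
  linked-sym (_ , w) = _ , reverse w

  linked-trans : ∀ {x y z} → Linked x y → Linked y z → Linked x z
  linked-trans (_ , w) (_ , w′) = _ , w ++ʷ w′

  path-from : ∀ {x y z k} (w : Walk G y z k) → Unique (vertices G w) →
              x ∈ₗ vertices G w → ∃ λ l → l ≤ k × Path G x z l
  path-from [ x ]        uniq       (here refl) = _ , z≤n , [ x ] , uniq
  path-from (x ∷⟨ e ⟩ w) uniq       (here refl) = _ , ≤-refl , (x ∷⟨ e ⟩ w) , uniq
  path-from (_ ∷⟨ _ ⟩ w) (_ ∷ uniq) (there x∈)  with path-from w uniq x∈
  ... | l , l≤k , p = l , m≤n⇒m≤1+n l≤k , p

  -- If the first vertex recurs later, `path-from` cuts out the loop. The bound `l ≤ k` lets
  -- distances be computed with walks instead of paths.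
  walk⇒path : DecidableEquality V → ∀ {x y k} → Walk G x y k →
              ∃ λ l → l ≤ k × Path G x y l
  walk⇒path _≟ⱽ_ [ x ]        = 0 , z≤n , [ x ] , [] ∷ []
  walk⇒path _≟ⱽ_ (x ∷⟨ e ⟩ w) with walk⇒path _≟ⱽ_ w
  ... | l , l≤k , w′ , uniq with Any.any? (x ≟ⱽ_) (vertices G w′)
  ...   | no  x∉ = suc l , s≤s l≤k , (x ∷⟨ e ⟩ w′) , ¬Any⇒All¬ _ x∉ ∷ uniq
  ...   | yes x∈ with path-from w′ uniq x∈
  ...     | m , m≤l , p = m , m≤n⇒m≤1+n (≤-trans m≤l l≤k) , p

  joined⇒linked : ∀ {x y} → Joined G x y → Linked x y
  joined⇒linked (k , w , _) = k , w

  linked⇒joined : DecidableEquality V → ∀ {x y} → Linked x y → Joined G x y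
  linked⇒joined _≟ⱽ_ (_ , w) with walk⇒path _≟ⱽ_ w
  ... | l , _ , p = l , p

  two-components⇒unlinked : DecidableEquality V → AtLeastTwoComponents G →
                            ∃ λ x → ∃ λ y → ¬ Linked x y
  two-components⇒unlinked _≟ⱽ_ (C , D , (x , C⊆ , ⊆C) , (y , D⊆ , ⊆D) , C≢D) =
    x , y , λ xy → C≢D
      ( (λ c → ⊆D (join (linked-trans (linked-sym xy) (joined⇒linked (C⊆ c)))))
      , (λ d → ⊆C (join (linked-trans xy (joined⇒linked (D⊆ d))))) )
    where
    join : ∀ {a b} → Linked a b → Joined G a b
    join = linked⇒joined _≟ⱽ_

-- The distance function and the existence of a metric basis.

module Metric {n : ℕ} (G : Graph (Fin n)) (connected : Connected G) where
  open Graph G using (Adj; adj?; irrefl)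

  walk? : ∀ x y k → Dec (Walk G x y k)
  walk? x y zero    = map′ (λ { refl → [ x ] }) (λ { [ _ ] → refl }) (x ≟ y)
  walk? x y (suc k) = map′ (λ { (_ , e , w) → x ∷⟨ e ⟩ w }) (λ { (_ ∷⟨ e ⟩ w) → _ , e , w })
                        (any? λ z → adj? x z ×-dec walk? z y k)

  private
    shortest : ∀ x y → ∃ λ k → Walk G x y k × (∀ {l} → Walk G x y l → k ≤ l)
    shortest x y with connected x y
    ... | k , w , _ = least (walk? x y) k w

  d : Fin n → Fin n → ℕ
  d x y = proj₁ (shortest x y)

  geodesic : ∀ x y → Walk G x y (d x y)
  geodesic x y = proj₁ (proj₂ (shortest x y))

  d-minimal : ∀ {x y l} → Walk G x y l → d x y ≤ l
  d-minimal {x} {y} = proj₂ (proj₂ (shortest x y))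

  d-distance : ∀ x y → Distance G x y (d x y)
  d-distance x y with walk⇒path _≟_ (geodesic x y)
  ... | l , l≤d , p =
    subst (Path G x y) (≤-antisym l≤d (d-minimal (proj₁ p))) p , λ q → d-minimal (proj₁ q)

  distance-unique : ∀ {x y k} → Distance G x y k → k ≡ d x y
  distance-unique {x} {y} (p , k≤) =
    ≤-antisym (k≤ (proj₁ (d-distance x y))) (d-minimal (proj₁ p))

  resolves⇒d≢ : ∀ {r x y} → Resolves G r x y → d r x ≢ d r y
  resolves⇒d≢ (_ , _ , Dx , Dy , k≢l) eq =
    k≢l (trans (distance-unique Dx) (trans eq (sym (distance-unique Dy))))

  d≢⇒resolves : ∀ {r x y} → d r x ≢ d r y → Resolves G r x y
  d≢⇒resolves {r} {x} {y} d≢ = _ , _ , d-distance r x , d-distance r y , d≢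

  d-refl : ∀ x → d x x ≡ 0
  d-refl x = n≤0⇒n≡0 (d-minimal [ x ])

  d≡0⇒≡ : ∀ {x y} → d x y ≡ 0 → x ≡ y
  d≡0⇒≡ {x} {y} eq with subst (Walk G x y) eq (geodesic x y)
  ... | [ _ ] = refl

  d-sym : ∀ x y → d x y ≡ d y x
  d-sym x y = ≤-antisym (d-minimal (reverse (geodesic y x))) (d-minimal (reverse (geodesic x y)))

  d-triangle : ∀ x y z → d x z ≤ d x y + d y z
  d-triangle x y z = d-minimal (geodesic x y ++ʷ geodesic y z)

  adj⇒d≡1 : ∀ {x y} → Adj x y → d x y ≡ 1
  adj⇒d≡1 {x} {y} e = ≤-antisym (d-minimal (x ∷⟨ e ⟩ [ y ]))
    (n≢0⇒n>0 λ eq → irrefl (d≡0⇒≡ eq) e)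

  d≡1⇒adj : ∀ {x y} → d x y ≡ 1 → Adj x y
  d≡1⇒adj {x} {y} eq with subst (Walk G x y) eq (geodesic x y)
  ... | _ ∷⟨ e ⟩ [ _ ] = e

  d-self≢ : ∀ {x y} → x ≢ y → d x x ≢ d x y
  d-self≢ x≢y eq = x≢y (d≡0⇒≡ (trans (sym eq) (d-refl _)))

  ⊤-resolving : ResolvingSet G ⊤
  ⊤-resolving x y x≢y = x , ∈⊤ , d≢⇒resolves (d-self≢ x≢y)

  -- Double negation avoids deciding ResolvingSet over all subsets, and suffices
  -- because being forced is only ever refuted.
  ¬¬-basis : ¬ ¬ (∃ λ R → MetricBasis G R)
  ¬¬-basis none = no-resolving ⊤ (<-wellFounded _) ⊤-resolving
    where
    no-resolving : ∀ R → Acc _<_ ∣ R ∣ → ¬ ResolvingSet G R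
    no-resolving R (acc smaller) res = none (R , res , (R , res , refl) , minimal)
      where
      minimal : ∀ R′ → ResolvingSet G R′ → ∣ R ∣ ≤ ∣ R′ ∣
      minimal R′ res′ = ≮⇒≥ λ lt → no-resolving R′ (smaller lt) res′

-- Distances to a pendant vertex.

module PendantVertex {n : ℕ} (G : Graph (Fin n)) (connected : Connected G)
                     (u v : Fin n) (u∼v : Graph.Adj G u v)
                     (u∼⇒≡v : ∀ {z} → Graph.Adj G u z → z ≡ v) where
  open Graph G using (Adj; adj?) renaming (sym to adj-sym)
  open Metric G connected

  d-pendant : ∀ {r} → r ≢ u → d r u ≡ suc (d r v)
  d-pendant {r} r≢u = ≤-antisym upper (lower (reverse (geodesic r u)))
    where
    upper : d r u ≤ suc (d r v)
    upper = d-minimal (subst (Walk G r u) (+-comm (d r v) 1)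
                         (geodesic r v ++ʷ (v ∷⟨ adj-sym u∼v ⟩ [ u ])))
    -- The walk is read from `u`, so that its first edge must lead to `v`.
    lower : ∀ {k} → Walk G u r k → suc (d r v) ≤ k
    lower [ _ ]        = contradiction refl r≢u
    lower (_ ∷⟨ e ⟩ w) with refl ← u∼⇒≡v e = s≤s (d-minimal (reverse w))

  -- Components of `G` without `u` and `v`.

  S : Subset n
  S = ⁅ v ⁆ ∪ ⁅ u ⁆

  Rest : Set
  Rest = [ x ∈ Fin n ∣ x ∉ S ]

  rest : ∀ {x} → x ≢ v → x ≢ u → Rest
  rest {x} x≢v x≢u = x , [ x∉S ]
    where
    x∉S : x ∉ S
    x∉S x∈ with x∈p∪q⁻ ⁅ v ⁆ ⁅ u ⁆ x∈
    ... | inj₁ x∈v = x≢v (x∈⁅y⁆⇒x≡y v x∈v)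
    ... | inj₂ x∈u = x≢u (x∈⁅y⁆⇒x≡y u x∈u)

  rest≢v : ∀ (a : Rest) → value a ≢ v
  rest≢v (_ , [ a∉ ]) refl = ⊥-elim-irr (a∉ (x∈p∪q⁺ (inj₁ (x∈⁅x⁆ v))))

  rest≢u : ∀ (a : Rest) → value a ≢ u
  rest≢u (_ , [ a∉ ]) refl = ⊥-elim-irr (a∉ (x∈p∪q⁺ {p = ⁅ v ⁆} (inj₂ (x∈⁅x⁆ u))))

  -- Avoiding `v` is enough to avoid `u`, which can be entered only from `v`.
  rest-neighbour : ∀ (a : Rest) {y} → Adj (value a) y → y ≢ v → Rest
  rest-neighbour a e y≢v = rest y≢v λ { refl → rest≢v a (u∼⇒≡v (adj-sym e)) }

  _⇝_ : Rest → Rest → Set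
  _⇝_ = Linked {G = G − S}

  ⇝-step : ∀ {a b c} → Adj (value a) (value b) → b ⇝ c → a ⇝ c
  ⇝-step e (_ , w) = _ , _ ∷⟨ e ⟩ w

  -- The endpoints are tied to vertices of G − S by equations, since Walk
  -- cannot be matched at indices of the form value a.
  walk-split : ∀ {x y k} → Walk G x y k → (a b : Rest) → value a ≡ x → value b ≡ y →
               a ⇝ b ⊎ d x v + d v y ≤ k
  walk-split [ _ ] a b refl b≡a with refl ← value-injective {v = b} {w = a} b≡a = inj₁ (0 , [ a ])
  walk-split {y = y} (_∷⟨_⟩_ x {z} {k = k} e w) a b refl b≡y with z ≟ v
  ... | yes refl = inj₂ (begin
    d x v + d v y ≤⟨ +-monoˡ-≤ (d v y) (≤-reflexive (adj⇒d≡1 e)) ⟩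
    suc (d v y)   ≤⟨ s≤s (d-minimal w) ⟩
    suc k         ∎)
    where open ≤-Reasoning
  ... | no z≢v with walk-split w (rest-neighbour a e z≢v) b refl b≡y
  ...   | inj₁ z⇝b = inj₁ (⇝-step e z⇝b)
  ...   | inj₂ le  = inj₂ (begin
    d x v + d v y       ≤⟨ +-monoˡ-≤ (d v y) (d-minimal (x ∷⟨ e ⟩ geodesic z v)) ⟩
    suc (d z v + d v y) ≤⟨ s≤s le ⟩
    suc k               ∎)
    where open ≤-Reasoning

  -- A geodesic that misses `v` stays inside `G − S`; one that meets `v` splits there.
  linked-or-through : ∀ a b → a ⇝ b ⊎ d (value a) v + d v (value b) ≤ d (value a) (value b)
  linked-or-through a b = walk-split (geodesic _ _) a b refl refl

  -- `c` is the vertex just before a geodesic from `a` first reaches `v`.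
  linked-to-neighbour-of-v : ∀ a → ∃ λ c → c ⇝ a × Adj v (value c)
  linked-to-neighbour-of-v a = go (geodesic (value a) v) a refl
    where
    go : ∀ {x k} → Walk G x v k → (a : Rest) → value a ≡ x → ∃ λ c → c ⇝ a × Adj v (value c)
    go [ _ ]              a a≡v = contradiction a≡v (rest≢v a)
    go (_∷⟨_⟩_ x {y} e w) a refl with y ≟ v
    ... | yes refl = a , (0 , [ a ]) , adj-sym e
    ... | no  y≢v with go w (rest-neighbour a e y≢v) refl
    ...   | c , c⇝y , v∼c = c , linked-sym (⇝-step e (linked-sym c⇝y)) , v∼c

  -- Twins of the pendant vertex.

  Twin : Subset n → Fin n → Set
  Twin Q y = y ≢ u × Adj v y × (∀ r → r ∈ Q → d r y ≡ d r u)

  unseparated? : ∀ Q y r → Dec (r ∈ Q → d r y ≡ d r u)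
  unseparated? Q y r = (r ∈? Q) →-dec (d r y ≟ⁿ d r u)

  twin? : ∀ Q y → Dec (Twin Q y)
  twin? Q y = ¬? (y ≟ u) ×-dec adj? v y ×-dec all? (unseparated? Q y)

  twin-or-separated : ∀ Q {y} → y ≢ u → Adj v y → Twin Q y ⊎ ∃ λ r → r ∈ Q × d r y ≢ d r u
  twin-or-separated Q {y} y≢u v∼y with all? (unseparated? Q y)
  ... | yes same = inj₁ (y≢u , v∼y , same)
  ... | no ¬same with ¬∀⟶∃¬ n _ (unseparated? Q y) ¬same
  ...   | r , ¬sep with r ∈? Q
  ...     | yes r∈Q = inj₂ (r , r∈Q , λ eq → ¬sep λ _ → eq)
  ...     | no  r∉Q = contradiction (λ r∈Q → contradiction r∈Q r∉Q) ¬sep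

  d-from-pendant : ∀ {x} → x ≢ u → d u x ≡ suc (d v x)
  d-from-pendant {x} x≢u = trans (d-sym u x) (trans (d-pendant x≢u) (cong suc (d-sym x v)))

  twin-unique : ∀ {R} → ResolvingSet G R → ∀ {y z} → Twin (R - u) y → Twin (R - u) z → y ≡ z
  twin-unique {R} res {y} {z} (y≢u , v∼y , y-same) (z≢u , v∼z , z-same) with y ≟ z
  ... | yes y≡z = y≡z
  ... | no  y≢z with res y z y≢z
  ...   | r , r∈R , rs with r ≟ u
  ...     | no r≢u = contradiction (trans (y-same r r∈) (sym (z-same r r∈))) (resolves⇒d≢ rs)
    where r∈ = x∈p∧x≢y⇒x∈p-y r∈R r≢u
  ...     | yes refl = contradiction same (resolves⇒d≢ rs)
    where
    -- Both distances are 2, through `v`.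
    same : d u y ≡ d u z
    same = trans (d-from-pendant y≢u) (trans (cong suc (trans (adj⇒d≡1 v∼y)
             (sym (adj⇒d≡1 v∼z)))) (sym (d-from-pendant z≢u)))

  -- Covers both choices of `R′`: `R - u` when there is no twin, and `R - u` with the twin added
  -- otherwise. `x₁` and `x₂` represent two components of `G − S`.
  module Exchange {R R′ : Subset n} (R-resolving : ResolvingSet G R)
                  (R-u⊆R′ : R - u ⊆ R′) (u∉R′ : u ∉ R′)
                  (twin∈R′ : ∀ {y} → Twin (R - u) y → y ∈ R′)
                  {x₁ x₂ : Rest} (x₁↛x₂ : ¬ x₁ ⇝ x₂) where

    ∈R′⇒≢u : ∀ {r} → r ∈ R′ → r ≢ u
    ∈R′⇒≢u r∈ refl = u∉R′ r∈

    component-meets-R′ : ∀ a → ∃ λ r → value r ∈ R′ × r ⇝ a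
    component-meets-R′ a with linked-to-neighbour-of-v a
    ... | c , c⇝a , v∼c with twin-or-separated (R - u) (rest≢u c) v∼c
    ...   | inj₁ twin = c , twin∈R′ twin , c⇝a
    ...   | inj₂ (r , r∈ , d≢) = r′ , r∈R′ , linked-trans r⇝c c⇝a
      where
      r∈R′ = R-u⊆R′ r∈
      dvc≡1 = adj⇒d≡1 v∼c
      -- Since `u` and `c` are both at distance 1 from `v`, a vertex that reaches `c` through `v`
      -- cannot tell them apart. This excludes `r` being `v` or lying in another component.
      dru≡ : d r u ≡ d r v + d v (value c)
      dru≡ = trans (d-pendant (∈R′⇒≢u r∈R′))
               (trans (+-comm 1 (d r v)) (cong (d r v +_) (sym dvc≡1)))
      r≢v : r ≢ v
      r≢v refl = d≢ (trans (cong (_+ d v (value c)) (sym (d-refl v))) (sym dru≡))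
      r′ = rest r≢v (∈R′⇒≢u r∈R′)
      r⇝c : r′ ⇝ c
      r⇝c with linked-or-through r′ c
      ... | inj₁ link = link
      ... | inj₂ le   = contradiction
        (trans (≤-antisym (d-triangle r v (value c)) le) (sym dru≡)) d≢

    -- Away from `u` and `v`, `y` cannot be linked to both `x₁` and `x₂`, so the member of `R′`
    -- found in one of these two components reaches `y` only through `v`.
    through-v : ∀ y → ∃ λ r → r ∈ R′ × d r v + d v y ≤ d r y
    through-v y with component-meets-R′ x₁ | component-meets-R′ x₂ | y ≟ v | y ≟ u
    ... | r₁ , r₁∈ , _ | _ | yes refl | _ = value r₁ , r₁∈ ,
      ≤-reflexive (trans (cong (d (value r₁) v +_) (d-refl v)) (+-identityʳ _))
    ... | r₁ , r₁∈ , _ | _ | no _ | yes refl = value r₁ , r₁∈ , (begin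
      d r v + d v u ≤⟨ +-monoʳ-≤ (d r v) (≤-reflexive (adj⇒d≡1 (adj-sym u∼v))) ⟩
      d r v + 1     ≡⟨ +-comm (d r v) 1 ⟩
      suc (d r v)   ≡⟨ d-pendant (rest≢u r₁) ⟨
      d r u         ∎)
      where
      open ≤-Reasoning
      r = value r₁
    ... | r₁ , r₁∈ , r₁⇝x₁ | r₂ , r₂∈ , r₂⇝x₂ | no y≢v | no y≢u
      with linked-or-through r₁ (rest y≢v y≢u) | linked-or-through r₂ (rest y≢v y≢u)
    ...   | inj₂ le | _       = value r₁ , r₁∈ , le
    ...   | inj₁ _  | inj₂ le = value r₂ , r₂∈ , le
    ...   | inj₁ r₁⇝y | inj₁ r₂⇝y = contradiction
      (linked-trans (linked-trans (linked-sym r₁⇝x₁) r₁⇝y)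
                    (linked-trans (linked-sym r₂⇝y) r₂⇝x₂)) x₁↛x₂

    closer-to-v : ∀ {x y} → d v x < d v y → ∃ λ r → r ∈ R′ × d r x ≢ d r y
    closer-to-v {x} {y} lt with through-v y
    ... | r , r∈ , le = r , r∈ , <⇒≢ (begin-strict
      d r x         ≤⟨ d-triangle r v x ⟩
      d r v + d v x <⟨ +-monoʳ-< (d r v) lt ⟩
      d r v + d v y ≤⟨ le ⟩
      d r y         ∎)
      where open ≤-Reasoning

    -- The equal distances are 1, so `y` is a neighbour of `v`; a twin separates itself from `u`.
    separates-from-u : ∀ {y} → y ≢ u → d v u ≡ d v y → ∃ λ r → r ∈ R′ × d r u ≢ d r y
    separates-from-u {y} y≢u eq
      with twin-or-separated (R - u) y≢u (d≡1⇒adj (trans (sym eq) (adj⇒d≡1 (adj-sym u∼v))))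
    ... | inj₁ twin          = y , twin∈R′ twin , ≢-sym (d-self≢ y≢u)
    ... | inj₂ (r , r∈ , d≢) = r , R-u⊆R′ r∈ , ≢-sym d≢

    equidistant-from-v : ∀ {x y} → x ≢ y → d v x ≡ d v y → ∃ λ r → r ∈ R′ × d r x ≢ d r y
    equidistant-from-v {x} {y} x≢y eq with x ≟ u | y ≟ u
    ... | yes refl | _        = separates-from-u (≢-sym x≢y) eq
    ... | no _     | yes refl with separates-from-u x≢y (sym eq)
    ...   | r , r∈ , d≢ = r , r∈ , ≢-sym d≢
    equidistant-from-v {x} {y} x≢y eq | no x≢u | no y≢u with R-resolving x y x≢y
    ... | r , r∈R , rs = r , R-u⊆R′ (x∈p∧x≢y⇒x∈p-y r∈R r≢u) , resolves⇒d≢ rs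
      where
      -- All distances from `u` to other vertices exceed those from `v` by one, so `u` cannot
      -- separate vertices equidistant from `v`.
      r≢u : r ≢ u
      r≢u refl = resolves⇒d≢ rs
        (trans (d-from-pendant x≢u) (trans (cong suc eq) (sym (d-from-pendant y≢u))))

    separated : ∀ {x y} → x ≢ y → ∃ λ r → r ∈ R′ × d r x ≢ d r y
    separated {x} {y} x≢y with <-cmp (d v x) (d v y)
    ... | tri< lt _ _ = closer-to-v lt
    ... | tri≈ _ eq _ = equidistant-from-v x≢y eq
    ... | tri> _ _ gt with closer-to-v gt
    ...   | r , r∈ , d≢ = r , r∈ , ≢-sym d≢

    R′-resolving : ResolvingSet G R′
    R′-resolving x y x≢y with separated x≢y
    ... | r , r∈ , d≢ = r , r∈ , d≢⇒resolves d≢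

  -- Refuting that the pendant vertex is forced.

  not-forced : ∀ {x₁ x₂ : Rest} → ¬ x₁ ⇝ x₂ → ∀ R → MetricBasis G R → ¬ BasisForced G u
  not-forced x₁↛x₂ R basis@(res , _ , minimal) forced with any? (twin? (R - u))
  -- Without a twin `R - u` already resolves, against the minimality of `R`.
  ... | no no-twin = n≮n _ (≤-trans (x∈p⇒∣p-x∣<∣p∣ u∈R) (minimal (R - u) R-u-resolving))
    where
    u∈R = forced R basis
    R-u-resolving = Exchange.R′-resolving res (λ r∈ → r∈) (x∉p-x R u)
                      (λ twin → contradiction (_ , twin) no-twin) x₁↛x₂
  ... | yes (y , twin) = u∉R′ (forced R′ (R′-resolving , (R′ , R′-resolving , refl) ,
      λ Q Q-res → ≤-trans ∣R′∣≤∣R∣ (minimal Q Q-res)))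
    where
    R′ = (R - u) ∪ ⁅ y ⁆
    u∉R′ : u ∉ R′
    u∉R′ u∈ with x∈p∪q⁻ (R - u) ⁅ y ⁆ u∈
    ... | inj₁ u∈R-u = x∉p-x R u u∈R-u
    ... | inj₂ u∈y   = proj₁ twin (sym (x∈⁅y⁆⇒x≡y y u∈y))
    -- Forcedness puts `u` in `R`, so its removal pays for adding `y`.
    ∣R′∣≤∣R∣ : ∣ R′ ∣ ≤ ∣ R ∣
    ∣R′∣≤∣R∣ = ≤-trans (∣p∪⁅x⁆∣≤1+∣p∣ (R - u) y) (x∈p⇒∣p-x∣<∣p∣ (forced R basis))
    R′-resolving : ResolvingSet G R′
    R′-resolving = Exchange.R′-resolving res (λ r∈ → x∈p∪q⁺ (inj₁ r∈)) u∉R′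
      (λ twin′ → x∈p∪q⁺ {p = R - u} (inj₂ (subst (_∈ ⁅ y ⁆) (twin-unique res twin twin′) (x∈⁅x⁆ y))))
      x₁↛x₂

theorem3 : (n : ℕ) (G : Graph (Fin n)) → Connected G →
    (u v : Fin n) → Pendant G u → Graph.Adj G u v → CutVertex G v →
    AtLeastTwoComponents (G − (⁅ v ⁆ ∪ ⁅ u ⁆)) →
    ¬ BasisForced G u
theorem3 n G connected u v (_ , _ , unique) u∼v _ two forced
  with two-components⇒unlinked (Refinement._≟_ _≟_) two
-- The goal is empty, so a basis may be taken from under the double negation. The neighbour supplied
-- by `Pendant` is identified with `v` through `unique`.
... | x₁ , x₂ , x₁↛x₂ = Metric.¬¬-basis G connected λ (R , basis) →
  PendantVertex.not-forced G connected u v u∼v (λ e → trans (sym (unique e)) (unique u∼v))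
    x₁↛x₂ R basis forced
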